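{- There exists a function $f:\mathbb{N}\to\mathbb{R}$ with $f(n)/n\to 0$ as $n\to\infty$ such that the following holds. Let $D$ be any digraph on $n$ vertices with $\chi(D)\ge 3$. Then $D$ contains a directed cycle of length at most $f(n)$. In other words, every such digraph of order $n$ contains a directed cycle of length $o(n)$.
   Context: Digraphs are loopless. A set $A\subseteq V(D)$ is acyclic if the induced subdigraph $D[A]$ contains no directed cycle. The chromatic number $\chi(D)$ of a digraph $D$ is the minimum integer $k$ such that $V(D)$ can be partitioned into at most $k$ acyclic sets. -}

module Defs where

open import Data.Nat using (ℕ; zero; suc; _≤_; _*_)
open import Data.Fin using (Fin; zero; suc; inject₁; fromℕ)
open import Data.Bool using (Bool; true)
open import Data.Product using (Σ; ∃; _×_)
open import Relation.Binary.PropositionalEquality using (_≡_)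
open import Relation.Nullary using (¬_)
open import Function.Definitions using (Injective)

-- A (finite, loopless) digraph on the vertex set Fin n.
-- arc u v = true  means there is an arc u → v.  Digons (u→v and v→u) are allowed.
record Digraph (n : ℕ) : Set where
  field
    arc      : Fin n → Fin n → Bool
    loopless : ∀ v → ¬ (arc v v ≡ true)
open Digraph public

-- A directed cycle of length (suc m): distinct vertices c 0, …, c m with
-- arcs c i → c (i+1) and c m → c 0.
record Cycle {n : ℕ} (D : Digraph n) (m : ℕ) : Set where
  field
    vtx      : Fin (suc m) → Fin n
    distinct : Injective _≡_ _≡_ vtx
    step     : ∀ (i : Fin m) → arc D (vtx (inject₁ i)) (vtx (suc i)) ≡ true
    close    : arc D (vtx (fromℕ m)) (vtx zero) ≡ true
open Cycle public

Acyclic : ∀ {n} → Digraph n → (Fin n → Set) → Set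
Acyclic D S = ∀ m (C : Cycle D m) → ¬ (∀ i → S (vtx C i))

ChromaticAtMost : ∀ {n} → Digraph n → ℕ → Set
ChromaticAtMost {n} D k =
  Σ (Fin n → Fin k) λ col → ∀ (j : Fin k) → Acyclic D (λ v → col v ≡ j)

ChromaticAtLeast3 : ∀ {n} → Digraph n → Set
ChromaticAtLeast3 D = ¬ ChromaticAtMost D 2

LittleO-n : (ℕ → ℕ) → Set
LittleO-n f = ∀ (k : ℕ) → 1 ≤ k → ∃ λ N → ∀ n → N ≤ n → k * f n ≤ n

{-# OPTIONS --safe #-}
module Submission where

-- Suppose D has no closed walk of length at most 2ℓh, where n < 2^ℓ and n ≤ h².
-- In a vertex set S, the out-ball and the in-ball of radius ℓh around v ∈ S meet
-- only in v, so one of them has at most (|S| + 1)/2 vertices.  A ball that grew by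
-- a factor above 1 + 1/h at each of the ℓh steps would have at least 2^ℓ > n vertices,
-- so some layer L around a smaller concentric ball B satisfies h|L| ≤ |B|.  Every cycle of
-- D[S ∖ L] lies inside B or outside B ∪ L.  Recursing on both sides, each vertex is
-- charged at most ℓ times, because B is always the smaller half.  This gives a
-- feedback vertex set F with h|F| ≤ ℓn, so |F| ≤ ℓh; as D has no cycle that short,
-- F is acyclic too, and D is 2-colourable.  Balancing ℓ and h yields
-- f(n) = O(√n log n).

open import Defs
open import Data.Nat using (ℕ; zero; suc; _+_; _*_; _^_; _≤_; _<_; z≤n; s≤s; s≤s⁻¹; _<?_; _≤?_; NonZero; >-nonZero⁻¹)
open import Data.Nat.Properties
open import Data.Nat.Induction using (<-wellFounded; Acc; acc)
open import Data.Nat.Tactic.RingSolver using (solve-∀)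
open import Data.Fin using (Fin; zero; suc; inject₁; fromℕ; fromℕ<; toℕ)
open import Data.Fin.Properties as Fin using (any?; toℕ<n; toℕ-inject₁; toℕ-fromℕ; toℕ-fromℕ<; toℕ-injective)
open import Data.Fin.Induction using (<-weakInduction; >-weakInduction)
open import Data.Bool using (Bool; true; false; not; _∧_; _∨_; if_then_else_)
open import Data.Bool.Properties as Bool using (∨-zeroʳ; ¬-not)
open import Data.Product using (Σ; ∃; _×_; _,_; proj₁)
open import Data.Sum using (_⊎_; inj₁; inj₂)
open import Function using (_∘_; flip)
open import Function.Definitions using (Injective)
open import Relation.Nullary using (¬_; Dec; yes; no; does; contradiction)
open import Relation.Nullary.Decidable using (_×-dec_; map′; dec-true; decidable-stable)
open import Relation.Binary.Definitions using (tri<; tri≈; tri>)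
open import Relation.Binary.PropositionalEquality using (_≡_; _≢_; refl; sym; trans; cong; cong₂; subst)
open import Algebra.Properties.CommutativeSemigroup +-commutativeSemigroup using (interchange)

-- Vertex sets and their sizes

VSet : ℕ → Set
VSet n = Fin n → Bool

Rel₂ : ℕ → Set
Rel₂ n = Fin n → Fin n → Bool

private
  variable
    n : ℕ
    E : Rel₂ n
    D : Digraph n

infix 4 _∈_ _⊆_
infixl 6 _∪_ _∖_

_∈_ : Fin n → VSet n → Set
x ∈ p = p x ≡ true

_⊆_ : VSet n → VSet n → Set
p ⊆ q = ∀ {x} → x ∈ p → x ∈ q

∅ : VSet n
∅ _ = false

⁅_⁆ : Fin n → VSet n
⁅ v ⁆ x = does (v Fin.≟ x)

_∪_ _∖_ : VSet n → VSet n → VSet n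
(p ∪ q) x = p x ∨ q x
(p ∖ q) x = p x ∧ not (q x)

bit : Bool → ℕ
bit true  = 1
bit false = 0

size : VSet n → ℕ
size {zero}  p = 0
size {suc n} p = bit (p zero) + size (p ∘ suc)

-- Two sets stand on each side so that every size inequality below, padded with `∅` where necessary,
-- reduces to a truth table at a single vertex.
size-+-≤ : (p q r s : VSet n) → (∀ x → bit (p x) + bit (q x) ≤ bit (r x) + bit (s x)) →
           size p + size q ≤ size r + size s
size-+-≤ {zero}  p q r s le = z≤n
size-+-≤ {suc n} p q r s le = begin
  (bit (p zero) + size (p ∘ suc)) + (bit (q zero) + size (q ∘ suc))
    ≡⟨ interchange (bit (p zero)) _ _ _ ⟩
  (bit (p zero) + bit (q zero)) + (size (p ∘ suc) + size (q ∘ suc))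
    ≤⟨ +-mono-≤ (le zero) (size-+-≤ (p ∘ suc) (q ∘ suc) (r ∘ suc) (s ∘ suc) (le ∘ suc)) ⟩
  (bit (r zero) + bit (s zero)) + (size (r ∘ suc) + size (s ∘ suc))
    ≡⟨ interchange (bit (r zero)) _ _ _ ⟩
  (bit (r zero) + size (r ∘ suc)) + (bit (s zero) + size (s ∘ suc)) ∎
  where open ≤-Reasoning

size-∅ : ∀ n → size (∅ {n}) ≡ 0
size-∅ zero    = refl
size-∅ (suc n) = size-∅ n

size-⁅⁆ : (v : Fin n) → size ⁅ v ⁆ ≡ 1
size-⁅⁆ {suc n} zero    = cong suc (size-∅ n)
size-⁅⁆ {suc n} (suc v) = size-⁅⁆ v

size≤n : (p : VSet n) → size p ≤ n
size≤n {zero}  p = z≤n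
size≤n {suc n} p with p zero
... | true  = s≤s (size≤n (p ∘ suc))
... | false = m≤n⇒m≤1+n (size≤n (p ∘ suc))

size-∪ : (p q : VSet n) → size (p ∪ q) ≤ size p + size q
size-∪ {n} p q = m+n≤o⇒m≤o _ (size-+-≤ (p ∪ q) ∅ p q (λ x → lemma (p x) (q x)))
  where
  lemma : ∀ a b → bit (a ∨ b) + 0 ≤ bit a + bit b
  lemma true  b     = s≤s z≤n
  lemma false true  = ≤-refl
  lemma false false = z≤n

size-∖ : (p q : VSet n) → q ⊆ p → size (p ∖ q) + size q ≤ size p
size-∖ {n} p q q⊆p = begin
  size (p ∖ q) + size q ≤⟨ size-+-≤ (p ∖ q) q p ∅ (λ x → lemma (p x) (q x) q⊆p) ⟩
  size p + size (∅ {n}) ≡⟨ cong (size p +_) (size-∅ n) ⟩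
  size p + 0            ≡⟨ +-identityʳ _ ⟩
  size p                ∎
  where
  open ≤-Reasoning
  lemma : ∀ a b → (b ≡ true → a ≡ true) → bit (a ∧ not b) + bit b ≤ bit a + 0
  lemma true  true  _ = ≤-refl
  lemma true  false _ = ≤-refl
  lemma false true  f with () ← f refl
  lemma false false _ = z≤n

size-mono : (p q : VSet n) → p ⊆ q → size p ≤ size q
size-mono p q p⊆q = m+n≤o⇒n≤o (size (q ∖ p)) (size-∖ q p p⊆q)

size-almost-disjoint : (p q r s : VSet n) → p ⊆ r → q ⊆ r →
                       (∀ {x} → x ∈ p → x ∈ q → x ∈ s) →
                       size p + size q ≤ size r + size s
size-almost-disjoint p q r s p⊆r q⊆r p∩q⊆s =
  size-+-≤ p q r s (λ x → lemma (p x) (q x) (r x) (s x) p⊆r q⊆r p∩q⊆s)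
  where
  lemma : ∀ a b c d → (a ≡ true → c ≡ true) → (b ≡ true → c ≡ true) →
          (a ≡ true → b ≡ true → d ≡ true) → bit a + bit b ≤ bit c + bit d
  lemma false false c d _ _ _ = z≤n
  lemma true  false c d f _ _ rewrite f refl = s≤s z≤n
  lemma false true  c d _ g _ rewrite g refl = s≤s z≤n
  lemma true  true  c d f _ h rewrite f refl | h refl refl = ≤-refl

x∈⁅x⁆ : (x : Fin n) → x ∈ ⁅ x ⁆
x∈⁅x⁆ x = dec-true (x Fin.≟ x) refl

∈⁅⁆⇒≡ : (v x : Fin n) → x ∈ ⁅ v ⁆ → v ≡ x
∈⁅⁆⇒≡ v x x∈ with yes v≡x ← v Fin.≟ x = v≡x

∈-∪ˡ : (p q : VSet n) → p ⊆ p ∪ q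
∈-∪ˡ p q x∈p rewrite x∈p = refl

∈-∪ʳ : (p q : VSet n) → q ⊆ p ∪ q
∈-∪ʳ p q {x} x∈q rewrite x∈q = ∨-zeroʳ (p x)

∈-∖ : (p q : VSet n) {x : Fin n} → x ∈ p → ¬ x ∈ q → x ∈ p ∖ q
∈-∖ p q x∈p x∉q rewrite x∈p | ¬-not x∉q = refl

∉-∖ : (p q : VSet n) {x : Fin n} → x ∈ p → ¬ x ∈ p ∖ q → x ∈ q
∉-∖ p q {x} x∈p x∉p∖q = decidable-stable (q x Bool.≟ true) (x∉p∖q ∘ ∈-∖ p q x∈p)

-- Applied to the vertices of a cycle, this bounds its length by the size of any set containing it.
-- Each step removes the image of `zero`, which no later index hits.
injection-size : ∀ {k} (p : VSet n) (c : Fin k → Fin n) → Injective _≡_ _≡_ c →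
                 (∀ i → c i ∈ p) → k ≤ size p
injection-size {k = zero}  p c inj c∈p = z≤n
injection-size {k = suc k} p c inj c∈p = begin
  suc k                                 ≡⟨ +-comm 1 k ⟩
  k + 1                                 ≤⟨ +-monoˡ-≤ 1 (injection-size (p ∖ ⁅ c zero ⁆) (c ∘ suc) (Fin.suc-injective ∘ inj) c∈p∖c₀) ⟩
  size (p ∖ ⁅ c zero ⁆) + 1             ≡⟨ cong (size (p ∖ ⁅ c zero ⁆) +_) (size-⁅⁆ (c zero)) ⟨
  size (p ∖ ⁅ c zero ⁆) + size ⁅ c zero ⁆
                                        ≤⟨ size-∖ p ⁅ c zero ⁆ (λ {x} x∈ → subst (_∈ p) (∈⁅⁆⇒≡ (c zero) x x∈) (c∈p zero)) ⟩
  size p                                ∎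
  where
  open ≤-Reasoning
  c∈p∖c₀ : ∀ i → c (suc i) ∈ p ∖ ⁅ c zero ⁆
  c∈p∖c₀ i = ∈-∖ p ⁅ c zero ⁆ (c∈p (suc i)) λ x∈ → Fin.0≢1+n (inj (∈⁅⁆⇒≡ (c zero) (c (suc i)) x∈))

-- Walks and cycles

data Walk (E : Rel₂ n) (u : Fin n) : ℕ → Fin n → Set where
  []  : Walk E u 0 u
  _▷_ : ∀ {i x y} → Walk E u i x → E x y ≡ true → Walk E u (suc i) y

walk? : (E : Rel₂ n) (u : Fin n) (i : ℕ) (x : Fin n) → Dec (Walk E u i x)
walk? E u zero    x = map′ (λ { refl → [] }) (λ { [] → refl }) (u Fin.≟ x)
walk? E u (suc i) x = map′ (λ (_ , w , e) → w ▷ e) (λ { (w ▷ e) → _ , w , e })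
  (any? λ y → walk? E u i y ×-dec (E y x Bool.≟ true))

-- The last arc of the reversed walk, read in its true direction, starts at `x`; it moves over to
-- the forward walk, and so on until the reversed walk is used up.
return : ∀ {u x y i j} → Walk E u i x → Walk (flip E) y j x → Walk E u (i + j) y
return {i = i} w []       rewrite +-identityʳ i = w
return {i = i} {j = suc j} w (w′ ▷ e) rewrite +-suc i j = return (w ▷ e) w′

-- Times past the end of the walk return its endpoint. A total function on ℕ can be shifted by
-- addition when a closed subwalk is cut out.
vertex : ∀ {E : Rel₂ n} {u i x} → Walk E u i x → ℕ → Fin n
vertex {u = u}         []      t = u
vertex {i = suc i} {x} (w ▷ e) t with t ≤? i
... | yes _ = vertex w t
... | no  _ = x

vertex-last : ∀ {u i x} (w : Walk E u i x) → vertex w i ≡ x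
vertex-last []      = refl
vertex-last {i = suc i} (w ▷ e) with suc i ≤? i
... | yes 1+i≤i = contradiction 1+i≤i 1+n≰n
... | no  _     = refl

vertex-first : ∀ {u i x} (w : Walk E u i x) → vertex w 0 ≡ u
vertex-first []      = refl
vertex-first (w ▷ e) = vertex-first w

vertex-step : ∀ {u i x} (w : Walk E u i x) t → t < i → E (vertex w t) (vertex w (suc t)) ≡ true
vertex-step {i = suc i} (w ▷ e) t t<1+i with t ≤? i | suc t ≤? i
... | no t≰i | _ = contradiction (s≤s⁻¹ t<1+i) t≰i
... | yes _  | yes t<i = vertex-step w t t<i
... | yes t≤i | no t≮i with refl ← ≤-antisym t≤i (≮⇒≥ t≮i) rewrite vertex-last w = e

-- A repeated vertex splits off a shorter closed walk.
closed⇒cycle : (D : Digraph n) (m : ℕ) → Acc _<_ m → (c : ℕ → Fin n) →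
               (∀ t → t ≤ m → arc D (c t) (c (suc t)) ≡ true) → c (suc m) ≡ c 0 →
               ∃ λ m′ → Cycle D m′ × m′ ≤ m
closed⇒cycle D m (acc rec) c steps closes
  -- Drawing `i` from `Fin (toℕ j)` encodes `i < j`.
  with any? {n = suc m} (λ j → any? {n = toℕ j} (λ i → c (toℕ i) Fin.≟ c (toℕ j)))
... | no none = m , record
  { vtx      = c ∘ toℕ
  ; distinct = λ {i} {j} → inj i j
  ; step     = λ i → subst (λ t → arc D (c t) (c (suc (toℕ i))) ≡ true)
                       (sym (toℕ-inject₁ i)) (steps (toℕ i) (<⇒≤ (toℕ<n i)))
  ; close    = subst (λ t → arc D (c t) (c 0) ≡ true) (sym (toℕ-fromℕ m))
                 (subst (λ x → arc D (c m) x ≡ true) closes (steps m ≤-refl))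
  } , ≤-refl
  where
  no-repeat : ∀ i (j : Fin (suc m)) → i < toℕ j → c i ≢ c (toℕ j)
  no-repeat i j i<j eq =
    none (j , fromℕ< i<j , trans (cong c (toℕ-fromℕ< i<j)) eq)
  inj : ∀ i j → c (toℕ i) ≡ c (toℕ j) → i ≡ j
  inj i j eq with <-cmp (toℕ i) (toℕ j)
  ... | tri< i<j _ _ = contradiction eq (no-repeat _ j i<j)
  ... | tri≈ _ i≡j _ = toℕ-injective i≡j
  ... | tri> _ _ j<i = contradiction (sym eq) (no-repeat _ i j<i)
... | yes (j , i , eq) =
  -- The stretch from time `i` to time `j` is a closed walk with `suc d` arcs, and `i + d < j ≤ m`
  -- gives `d < m`.
  let d , 1+i+d≡j = m≤n⇒∃[o]m+o≡n {suc (toℕ i)} {toℕ j} (toℕ<n i)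
      i+1+d≡j = trans (+-suc (toℕ i) d) 1+i+d≡j
      i+d<m = subst (_≤ m) (sym 1+i+d≡j) (s≤s⁻¹ (toℕ<n j))
      d<m = ≤-<-trans (m≤n+m d (toℕ i)) i+d<m
      m′ , C , m′≤d = closed⇒cycle D d (rec d<m) (λ t → c (toℕ i + t))
        (λ t t≤d → subst (λ z → arc D (c (toℕ i + t)) (c z) ≡ true) (sym (+-suc (toℕ i) t))
                     (steps (toℕ i + t) (≤-trans (+-monoʳ-≤ (toℕ i) t≤d) (<⇒≤ i+d<m))))
        (trans (cong c i+1+d≡j) (trans (sym eq) (cong c (sym (+-identityʳ (toℕ i))))))
  in m′ , C , ≤-trans m′≤d (<⇒≤ d<m)

walk⇒cycle : (D : Digraph n) {m : ℕ} {u : Fin n} → Walk (arc D) u (suc m) u →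
             ∃ λ m′ → Cycle D m′ × m′ ≤ m
walk⇒cycle D {m} w = closed⇒cycle D m (<-wellFounded m) (vertex w)
  (λ t t≤m → vertex-step w t (s≤s t≤m)) (trans (vertex-last w) (sym (vertex-first w)))

cycle⇒walk : ∀ {m} (C : Cycle D m) → Walk (arc D) (vtx C zero) (suc m) (vtx C zero)
cycle⇒walk {D = D} {m = m} C = subst (λ i → Walk (arc D) (vtx C zero) i (vtx C (fromℕ m))) (toℕ-fromℕ m) (prefix (fromℕ m)) ▷ close C
  where
  prefix : ∀ i → Walk (arc D) (vtx C zero) (toℕ i) (vtx C i)
  prefix = <-weakInduction _ [] λ i w →
    subst (λ t → Walk (arc D) (vtx C zero) t (vtx C (inject₁ i))) (toℕ-inject₁ i) w ▷ step C i

-- Membership travels forward around the cycle from `vtx C zero`. Non-membership travels backward,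
-- first through the closing arc to the last vertex.
forward-closed : {D : Digraph n} {m : ℕ} (C : Cycle D m) (p : VSet n) →
                 (∀ {i j} → arc D (vtx C i) (vtx C j) ≡ true → vtx C i ∈ p → vtx C j ∈ p) →
                 (∀ i → vtx C i ∈ p) ⊎ (∀ i → ¬ vtx C i ∈ p)
forward-closed C p closed with p (vtx C zero) Bool.≟ true
... | yes v₀∈p = inj₁ (<-weakInduction _ v₀∈p λ i → closed (step C i))
... | no  v₀∉p = inj₂ (>-weakInduction _ (v₀∉p ∘ closed (close C)) λ i v∉p → v∉p ∘ closed (step C i))

backward-closed : {D : Digraph n} {m : ℕ} (C : Cycle D m) (p : VSet n) →
                  (∀ {i j} → arc D (vtx C i) (vtx C j) ≡ true → vtx C j ∈ p → vtx C i ∈ p) →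
                  (∀ i → vtx C i ∈ p) ⊎ (∀ i → ¬ vtx C i ∈ p)
backward-closed C p closed with p (vtx C (fromℕ _)) Bool.≟ true
... | yes v∈p = inj₁ (>-weakInduction _ v∈p λ i → closed (step C i))
... | no  v∉p = inj₂ (<-weakInduction _ (v∉p ∘ closed (close C)) λ i v∉p → v∉p ∘ closed (step C i))

-- Balls

anyᵇ : VSet n → Bool
anyᵇ p = does (any? λ x → p x Bool.≟ true)

-- For `v` in `S` these are distance balls in the subdigraph induced on `S`; passing `flip E` for
-- `E` gives in-balls.
ball : Rel₂ n → VSet n → Fin n → ℕ → VSet n
ball E S v zero    = ⁅ v ⁆
ball E S v (suc i) = ball E S v i ∪ λ x → S x ∧ anyᵇ (λ y → ball E S v i y ∧ E y x)

layer : Rel₂ n → VSet n → Fin n → ℕ → VSet n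
layer E S v i = ball E S v (suc i) ∖ ball E S v i

module _ (E : Rel₂ n) (S : VSet n) (v : Fin n) where

  ball-suc : ∀ i → ball E S v i ⊆ ball E S v (suc i)
  ball-suc i = ∈-∪ˡ (ball E S v i) λ x → S x ∧ anyᵇ (λ y → ball E S v i y ∧ E y x)

  ball-≤ : ∀ {i j} → i ≤ j → ball E S v i ⊆ ball E S v j
  ball-≤ {j = zero}  z≤n x∈ = x∈
  ball-≤ {j = suc j} i≤1+j {x} x∈ with m≤n⇒m<n∨m≡n i≤1+j
  ... | inj₁ i<1+j = ball-suc j {x} (ball-≤ (s≤s⁻¹ i<1+j) {x} x∈)
  ... | inj₂ refl  = x∈

  ball-step : ∀ i {x y} → x ∈ ball E S v i → y ∈ S → E x y ≡ true → y ∈ ball E S v (suc i)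
  ball-step i {x} {y} x∈ y∈S e = ∈-∪ʳ (ball E S v i) (λ y → S y ∧ anyᵇ (λ z → ball E S v i z ∧ E z y)) y∈new
    where
    y∈new : S y ∧ anyᵇ (λ z → ball E S v i z ∧ E z y) ≡ true
    y∈new rewrite y∈S = dec-true (any? _) (x , cong₂ _∧_ x∈ e)

  ball-pred : ∀ i {y} → y ∈ ball E S v (suc i) →
              y ∈ ball E S v i ⊎ (y ∈ S × ∃ λ x → x ∈ ball E S v i × E x y ≡ true)
  ball-pred i {y} y∈ with ball E S v i y | S y
    -- Abstracting the decision itself rather than its Boolean exposes the predecessor as a witness.
    | any? (λ z → (ball E S v i z ∧ E z y) Bool.≟ true)
  ... | true  | _    | _ = inj₁ refl
  ... | false | true | yes (x , eq) with ball E S v i x in x∈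
  ...   | true = inj₂ (refl , x , x∈ , eq)

  ball⊆S : v ∈ S → ∀ i → ball E S v i ⊆ S
  ball⊆S v∈S zero    {x} x∈ = subst (_∈ S) (∈⁅⁆⇒≡ v x x∈) v∈S
  ball⊆S v∈S (suc i) {x} x∈ with ball-pred i x∈
  ... | inj₁ x∈B       = ball⊆S v∈S i x∈B
  ... | inj₂ (x∈S , _) = x∈S

  ball⇒walk : ∀ i {x} → x ∈ ball E S v i → ∃ λ j → Walk E v j x × j ≤ i
  ball⇒walk zero    {x} x∈ with refl ← ∈⁅⁆⇒≡ v x x∈ = 0 , [] , z≤n
  ball⇒walk (suc i) {x} x∈ with ball-pred i x∈
  ... | inj₁ x∈B              = let j , w , j≤i = ball⇒walk i x∈B in j , w , m≤n⇒m≤1+n j≤i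
  ... | inj₂ (_ , y , y∈ , e) = let j , w , j≤i = ball⇒walk i y∈ in suc j , w ▷ e , s≤s j≤i

  ball-layer : ∀ i → size (ball E S v i) + size (layer E S v i) ≤ size (ball E S v (suc i))
  ball-layer i = ≤-trans (≤-reflexive (+-comm (size (ball E S v i)) _))
    (size-∖ (ball E S v (suc i)) (ball E S v i) (λ {x} → ball-suc i {x}))

-- Growth of balls

module Growth (h : ℕ) .{{_ : NonZero h}} (b d : ℕ → ℕ) (b+d≤b : ∀ i → b i + d i ≤ b (suc i)) where

  b-mono : ∀ j t → b j ≤ b (t + j)
  b-mono j zero    = ≤-refl
  b-mono j (suc t) = ≤-trans (b-mono j t) (m+n≤o⇒m≤o _ (b+d≤b (t + j)))

  -- As long as every layer is thick, each step adds more than `b i / h`, hence more than `b j / h`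
  -- because `b` is monotone. The inequality is this count multiplied by `h`.
  linear : ∀ j t → (∃ λ i → i < t + j × h * d i ≤ b i) ⊎ h * b j + t * b j ≤ h * b (t + j)
  linear j zero    = inj₂ (≤-reflexive (+-identityʳ _))
  linear j (suc t) with linear j t
  ... | inj₁ (i , i< , thin) = inj₁ (i , m<n⇒m<1+n i< , thin)
  ... | inj₂ grown with h * d (t + j) ≤? b (t + j)
  ...   | yes thin = inj₁ (t + j , ≤-refl , thin)
  ...   | no thick = inj₂ (begin
    h * b j + (b j + t * b j)       ≡⟨ cong (h * b j +_) (+-comm (b j) _) ⟩
    h * b j + (t * b j + b j)       ≡⟨ +-assoc (h * b j) _ _ ⟨
    h * b j + t * b j + b j         ≤⟨ +-mono-≤ grown (≤-trans (b-mono j t) (<⇒≤ (≰⇒> thick))) ⟩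
    h * b (t + j) + h * d (t + j)   ≡⟨ *-distribˡ-+ h _ _ ⟨
    h * (b (t + j) + d (t + j))     ≤⟨ *-monoʳ-≤ h (b+d≤b (t + j)) ⟩
    h * b (suc (t + j))             ∎)
    where open ≤-Reasoning

  -- `linear` with `t = h` says that `h` consecutive thick layers at least double the ball.
  exponential : ∀ l → (∃ λ i → i < l * h × h * d i ≤ b i) ⊎ 2 ^ l * b 0 ≤ b (l * h)
  exponential zero    = inj₂ (≤-reflexive (+-identityʳ _))
  exponential (suc l) with exponential l | linear (l * h) h
  ... | inj₁ (i , i< , thin) | _ = inj₁ (i , <-≤-trans i< (m≤n+m _ h) , thin)
  ... | inj₂ _     | inj₁ thin   = inj₁ thin
  ... | inj₂ grown | inj₂ double = inj₂ (begin
    2 * 2 ^ l * b 0     ≡⟨ *-assoc 2 (2 ^ l) (b 0) ⟩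
    2 * (2 ^ l * b 0)   ≤⟨ *-monoʳ-≤ 2 grown ⟩
    2 * b (l * h)       ≤⟨ *-cancelˡ-≤ h (≤-trans (≤-reflexive (twice h (b (l * h)))) double) ⟩
    b (h + l * h)       ∎)
    where
    open ≤-Reasoning
    twice : ∀ x y → x * (2 * y) ≡ x * y + x * y
    twice = solve-∀

-- Feedback vertex sets of digraphs without short closed walks

module Feedback (D : Digraph n) (h ℓ : ℕ) .{{_ : NonZero h}} .{{_ : NonZero ℓ}} (n<2^ℓ : n < 2 ^ ℓ)
  (no-short : ∀ {m u} → suc m ≤ 2 * (ℓ * h) → ¬ Walk (arc D) u (suc m) u) where

  R : ℕ
  R = ℓ * h

  long-cycle : ∀ {m} (p : VSet n) (C : Cycle D m) → (∀ i → vtx C i ∈ p) → ¬ size p ≤ 2 * R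
  long-cycle p C C∈p p≤2R =
    no-short (≤-trans (injection-size p (vtx C) (distinct C) C∈p) p≤2R) (cycle⇒walk C)

  -- The parameter `l` is a charging budget: each vertex of `S` may pay `1/h` of a vertex of `F` at
  -- most `l` times. Ranging over cycles of `D` that lie in `S` avoids forming induced subdigraphs.
  FeedbackSet : ℕ → VSet n → Set
  FeedbackSet l S = Σ (VSet n) λ F → h * size F ≤ l * size S ×
    (∀ {m} (C : Cycle D m) → (∀ i → vtx C i ∈ S) → ¬ (∀ i → ¬ vtx C i ∈ F))

  ∅-feedback : ∀ l S → (∀ {m} (C : Cycle D m) → ¬ (∀ i → vtx C i ∈ S)) → FeedbackSet l S
  ∅-feedback l S acyclic = ∅ ,
    ≤-trans (≤-reflexive (trans (cong (h *_) (size-∅ n)) (*-zeroʳ h))) z≤n ,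
    λ C C∈S _ → acyclic C C∈S

  -- A walk from `v` to `x` followed by a walk back is closed of length at most `2R`, so it must be
  -- empty.
  balls-meet : ∀ {S : VSet n} {v x} → x ∈ ball (arc D) S v R → x ∈ ball (flip (arc D)) S v R → x ∈ ⁅ v ⁆
  balls-meet {S} {v} {x} x∈out x∈in
    with ball⇒walk (arc D) S v R x∈out | ball⇒walk (flip (arc D)) S v R x∈in
  ... | zero  , [] , _    | _ = x∈⁅x⁆ x
  ... | suc i , w  , i<R  | j , w′ , j≤R = contradiction (return w w′)
    (no-short (+-mono-≤ i<R (≤-trans j≤R (≤-reflexive (sym (+-identityʳ R))))))

  -- Only `separate` depends on the direction of the arcs; everything else about balls is uniform in
  -- `E`.
  data Orientation : Rel₂ n → Set where
    outward : Orientation (arc D)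
    inward  : Orientation (flip (arc D))

  -- Only `v` is counted twice when the sizes of the two balls are added, so the smaller ball has at
  -- most half of `size S + 1`.
  small-ball : ∀ {S : VSet n} {v} → v ∈ S →
               ∃ λ E → Orientation E × 2 * size (ball E S v R) ≤ size S + 1
  small-ball {S} {v} v∈S = choose (≤-total (size B⁺) (size B⁻))
    where
    open ≤-Reasoning
    B⁺ B⁻ : VSet n
    B⁺ = ball (arc D) S v R
    B⁻ = ball (flip (arc D)) S v R
    both : size B⁺ + size B⁻ ≤ size S + 1
    both = subst (λ t → size B⁺ + size B⁻ ≤ size S + t) (size-⁅⁆ v)
      (size-almost-disjoint B⁺ B⁻ S ⁅ v ⁆ (ball⊆S (arc D) S v v∈S R)
        (ball⊆S (flip (arc D)) S v v∈S R) (balls-meet {S}))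
    choose : size B⁺ ≤ size B⁻ ⊎ size B⁻ ≤ size B⁺ →
             ∃ λ E → Orientation E × 2 * size (ball E S v R) ≤ size S + 1
    choose (inj₁ le) = arc D , outward , (begin
      2 * size B⁺            ≡⟨ cong (size B⁺ +_) (+-identityʳ _) ⟩
      size B⁺ + size B⁺      ≤⟨ +-monoʳ-≤ (size B⁺) le ⟩
      size B⁺ + size B⁻      ≤⟨ both ⟩
      size S + 1             ∎)
    choose (inj₂ le) = flip (arc D) , inward , (begin
      2 * size B⁻            ≡⟨ cong (size B⁻ +_) (+-identityʳ _) ⟩
      size B⁻ + size B⁻      ≤⟨ +-monoˡ-≤ (size B⁻) le ⟩
      size B⁺ + size B⁻      ≤⟨ both ⟩
      size S + 1             ∎)

  thin-layer : ∀ E (S : VSet n) v → ∃ λ i → i < R × h * size (layer E S v i) ≤ size (ball E S v i)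
  thin-layer E S v with Growth.exponential h (λ i → size (ball E S v i)) (λ i → size (layer E S v i))
                          (ball-layer E S v) ℓ
  ... | inj₁ thin  = thin
  -- If no layer were thin, `ℓ` doublings of the single vertex `v` would exceed `n`.
  ... | inj₂ grown = contradiction (≤-trans n<2^ℓ 2^ℓ≤n) 1+n≰n
    where
    open ≤-Reasoning
    2^ℓ≤n : 2 ^ ℓ ≤ n
    2^ℓ≤n = begin
      2 ^ ℓ                  ≡⟨ *-identityʳ _ ⟨
      2 ^ ℓ * 1              ≡⟨ cong (2 ^ ℓ *_) (size-⁅⁆ v) ⟨
      2 ^ ℓ * size ⁅ v ⁆     ≤⟨ grown ⟩
      size (ball E S v R)    ≤⟨ size≤n _ ⟩
      n                      ∎

  -- Within `S`, an arc leaving an out-ball ends in the next layer, and an arc entering an in-ball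
  -- starts there. A cycle avoiding the layer therefore never crosses the boundary of the ball.
  separate : ∀ {E} {S : VSet n} {v m} → Orientation E → ∀ i (C : Cycle D m) → (∀ t → vtx C t ∈ S) →
             (∀ t → ¬ vtx C t ∈ layer E S v i) →
             (∀ t → vtx C t ∈ ball E S v i) ⊎ (∀ t → ¬ vtx C t ∈ ball E S v i)
  separate {S = S} {v} outward i C C∈S C∉L = forward-closed C (ball (arc D) S v i) λ {_} {t} e s∈ →
    ∉-∖ (ball (arc D) S v (suc i)) (ball (arc D) S v i) (ball-step (arc D) S v i s∈ (C∈S t) e) (C∉L t)
  separate {S = S} {v} inward i C C∈S C∉L = backward-closed C (ball (flip (arc D)) S v i) λ {s} {_} e t∈ →
    ∉-∖ (ball (flip (arc D)) S v (suc i)) (ball (flip (arc D)) S v i) (ball-step (flip (arc D)) S v i t∈ (C∈S s) e) (C∉L s)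

  -- The layer costs each vertex of the ball one extra charge, raising its budget from `l` to
  -- `suc l`; the vertices outside already have budget `suc l` and pay nothing new.
  combine : ∀ {l E} {S : VSet n} {v} → Orientation E → v ∈ S → ∀ i →
            h * size (layer E S v i) ≤ size (ball E S v i) →
            FeedbackSet l (ball E S v i) → FeedbackSet (suc l) (S ∖ ball E S v (suc i)) →
            FeedbackSet (suc l) S
  combine {l} {E} {S} {v} o v∈S i thin (F₁ , F₁≤ , hit₁) (F₂ , F₂≤ , hit₂) = F₁ ∪ (L ∪ F₂) , bound , hit
    where
    B B⁺ L S′ : VSet n
    B  = ball E S v i
    B⁺ = ball E S v (suc i)
    L  = layer E S v i
    S′ = S ∖ B⁺
    open ≤-Reasoning
    distrib : ∀ a x y z → a * (x + (y + z)) ≡ a * x + (a * y + a * z)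
    distrib = solve-∀
    collect : ∀ a x y → a * x + (x + (y + a * y)) ≡ (y + x) + a * (y + x)
    collect = solve-∀
    bound : h * size (F₁ ∪ (L ∪ F₂)) ≤ suc l * size S
    bound = begin
      h * size (F₁ ∪ (L ∪ F₂))
        ≤⟨ *-monoʳ-≤ h (≤-trans (size-∪ F₁ _) (+-monoʳ-≤ (size F₁) (size-∪ L F₂))) ⟩
      h * (size F₁ + (size L + size F₂))
        ≡⟨ distrib h (size F₁) (size L) (size F₂) ⟩
      h * size F₁ + (h * size L + h * size F₂)
        ≤⟨ +-mono-≤ F₁≤ (+-mono-≤ thin F₂≤) ⟩
      l * size B + (size B + suc l * size S′)
        ≡⟨ collect l (size B) (size S′) ⟩
      suc l * (size S′ + size B)
        ≤⟨ *-monoʳ-≤ (suc l) (+-monoʳ-≤ (size S′) (size-mono B B⁺ (λ {x} → ball-suc E S v i {x}))) ⟩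
      suc l * (size S′ + size B⁺)
        ≤⟨ *-monoʳ-≤ (suc l) (size-∖ S B⁺ (ball⊆S E S v v∈S (suc i))) ⟩
      suc l * size S ∎
    hit : ∀ {m} (C : Cycle D m) → (∀ t → vtx C t ∈ S) → ¬ (∀ t → ¬ vtx C t ∈ F₁ ∪ (L ∪ F₂))
    hit C C∈S C∉F with separate {S = S} {v} o i C C∈S (λ t → C∉F t ∘ ∈-∪ʳ F₁ (L ∪ F₂) ∘ ∈-∪ˡ L F₂)
    ... | inj₁ C∈B = hit₁ C C∈B (λ t → C∉F t ∘ ∈-∪ˡ F₁ (L ∪ F₂))
    ... | inj₂ C∉B = hit₂ C
      -- A cycle vertex in `B⁺` but outside `B` would lie in the layer.
      (λ t → ∈-∖ S B⁺ (C∈S t) λ t∈B⁺ →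
        C∉F t (∈-∪ʳ F₁ (L ∪ F₂) (∈-∪ˡ L F₂ (∈-∖ B⁺ B t∈B⁺ (C∉B t)))))
      (λ t → C∉F t ∘ ∈-∪ʳ F₁ (L ∪ F₂) ∘ ∈-∪ʳ L F₂)

  -- The bound 2 ^ l + 1 is preserved because (2 ^ (l + 1) + 1 + 1) / 2 = 2 ^ l + 1.
  feedback : ∀ l (S : VSet n) → size S ≤ 2 ^ l + 1 → FeedbackSet l S
  peel : ∀ l s (S : VSet n) → size S ≤ s → size S ≤ 2 ^ suc l + 1 → FeedbackSet (suc l) S

  -- Here `2 ^ 0 + 1 = 2`: a cycle in `S` would have length at most 2, which `no-short` forbids
  -- since `R ≥ 1`.
  feedback zero    S S≤2 = ∅-feedback 0 S λ C C∈S → long-cycle S C C∈S (≤-trans S≤2 (*-monoʳ-≤ 2 1≤R))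
    where
    1≤R : 1 ≤ R
    1≤R = *-mono-≤ (>-nonZero⁻¹ ℓ) (>-nonZero⁻¹ h)
  feedback (suc l) S S≤ = peel l (size S) S ≤-refl S≤

  peel l s S S≤s S≤ with any? (λ v → S v Bool.≟ true)
  ... | no empty = ∅-feedback (suc l) S λ C C∈S → empty (vtx C zero , C∈S zero)
  peel l zero    S S≤s S≤ | yes (v , v∈S) =
    contradiction (≤-trans (injection-size {k = 1} S (λ _ → v) (λ { {zero} {zero} _ → refl }) (λ _ → v∈S)) S≤s) λ ()
  peel l (suc s) S S≤s S≤ | yes (v , v∈S) with small-ball {S} v∈S
  ... | E , o , small with thin-layer E S v
  -- The ball has been halved and drops to level `l`. The remainder stays at level `suc l` but loses
  -- a vertex, so the bound `s` makes the recursion terminate.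
  ... | i , i<R , thin = combine {l} o v∈S i thin
    (feedback l B (*-cancelˡ-≤ 2 2B≤))
    (peel l s S′ (s≤s⁻¹ (≤-trans S′<S S≤s)) (≤-trans (<⇒≤ S′<S) S≤))
    where
    open ≤-Reasoning
    B B⁺ S′ : VSet n
    B  = ball E S v i
    B⁺ = ball E S v (suc i)
    S′ = S ∖ B⁺
    double : ∀ x → 2 * x + 1 + 1 ≡ 2 * (x + 1)
    double = solve-∀
    2B≤ : 2 * size B ≤ 2 * (2 ^ l + 1)
    2B≤ = begin
      2 * size B                ≤⟨ *-monoʳ-≤ 2 (size-mono B _ (λ {x} → ball-≤ E S v (<⇒≤ i<R) {x})) ⟩
      2 * size (ball E S v R)   ≤⟨ small ⟩
      size S + 1                ≤⟨ +-monoˡ-≤ 1 S≤ ⟩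
      2 ^ suc l + 1 + 1         ≡⟨ double (2 ^ l) ⟩
      2 * (2 ^ l + 1)           ∎
    -- The centre `v` lies in `B⁺`, so at least one vertex is removed.
    S′<S : size S′ < size S
    S′<S = begin
      suc (size S′)             ≡⟨ +-comm 1 (size S′) ⟩
      size S′ + 1               ≡⟨ cong (size S′ +_) (size-⁅⁆ v) ⟨
      size S′ + size ⁅ v ⁆      ≤⟨ +-monoʳ-≤ (size S′) (size-mono ⁅ v ⁆ B⁺ (λ {x} → ball-≤ E S v {j = suc i} z≤n {x})) ⟩
      size S′ + size B⁺         ≤⟨ size-∖ S B⁺ (ball⊆S E S v v∈S (suc i)) ⟩
      size S                    ∎

  two-colourable : n ≤ h * h → ChromaticAtMost D 2
  two-colourable n≤h² with feedback ℓ (λ _ → true) (≤-trans (size≤n _) (≤-trans (<⇒≤ n<2^ℓ) (m≤m+n _ 1)))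
  ... | F , F≤ , hit = (λ v → if F v then suc zero else zero) , acyclic
    where
    open ≤-Reasoning
    -- The hypothesis `n ≤ h * h` enters here: it makes `F` too small to contain a cycle, so `F` can
    -- serve as a colour class.
    F≤R : size F ≤ R
    F≤R = *-cancelˡ-≤ h (begin
      h * size F            ≤⟨ F≤ ⟩
      ℓ * size {n} (λ _ → true) ≤⟨ *-monoʳ-≤ ℓ (≤-trans (size≤n _) n≤h²) ⟩
      ℓ * (h * h)           ≡⟨ *-assoc ℓ h h ⟨
      R * h                 ≡⟨ *-comm R h ⟩
      h * R                 ∎)
    colour-0 : ∀ b → (if b then suc zero else zero) ≡ zero {1} → ¬ b ≡ true
    colour-0 true  ()
    colour-0 false _ ()
    colour-1 : ∀ b → (if b then suc zero else zero) ≡ suc {1} zero → b ≡ true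
    colour-1 true  _ = refl
    colour-1 false ()
    acyclic : (j : Fin 2) → Acyclic D (λ v → (if F v then suc zero else zero) ≡ j)
    acyclic zero       m C C∈ = hit C (λ _ → refl) (λ i → colour-0 _ (C∈ i))
    acyclic (suc zero) m C C∈ = long-cycle F C (λ i → colour-1 _ (C∈ i)) (≤-trans F≤R (m≤m+n R _))

-- As `ChromaticAtLeast3` is a negation, the cycle itself comes from a finite decidable search for
-- closed walks; a failed search yields a 2-colouring.
short-cycle : (D : Digraph n) (h ℓ : ℕ) .{{_ : NonZero h}} .{{_ : NonZero ℓ}} → n < 2 ^ ℓ → n ≤ h * h →
              ChromaticAtLeast3 D → ∃ λ m → Cycle D m × suc m ≤ 2 * (ℓ * h)
short-cycle D h ℓ n<2^ℓ n≤h² χ≥3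
  with any? {n = 2 * (ℓ * h)} (λ m → any? λ u → walk? (arc D) u (suc (toℕ m)) u)
... | yes (m , u , w) = let m′ , C , m′≤m = walk⇒cycle D w in m′ , C , ≤-trans (s≤s m′≤m) (toℕ<n m)
... | no none = contradiction (Feedback.two-colourable D h ℓ n<2^ℓ no-short n≤h²) χ≥3
  where
  no-short : ∀ {m u} → suc m ≤ 2 * (ℓ * h) → ¬ Walk (arc D) u (suc m) u
  no-short m< w = none (fromℕ< m< , _ , subst (λ t → Walk _ _ (suc t) _) (sym (toℕ-fromℕ< m<)) w)

-- The function f

log₄ : ∀ n → ∃ λ q → 2 ^ q * 2 ^ q ≤ suc n × suc n < 2 ^ suc q * 2 ^ suc q
log₄ zero    = 0 , ≤-refl , s≤s (s≤s z≤n)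
log₄ (suc n) with log₄ n
... | q , 4^q≤ , <4^1+q with suc (suc n) <? 2 ^ suc q * 2 ^ suc q
...   | yes lt = q , m≤n⇒m≤1+n 4^q≤ , lt
-- The argument grew by only one, so the exponent rises by at most one.
...   | no ≮  = suc q , ≮⇒≥ ≮ , ≤-<-trans <4^1+q (*-mono-< 2^q< 2^q<)
  where
  2^q< : 2 ^ suc q < 2 ^ suc (suc q)
  2^q< = ^-monoʳ-< 2 (s≤s (s≤s z≤n)) (n<1+n (suc q))

⌊log₄1+_⌋ : ℕ → ℕ
⌊log₄1+ n ⌋ = proj₁ (log₄ n)

-- This is `2 * (ℓ * h)` with `h = 2 ^ q` and `ℓ = q + q`, where `2 ^ q` is of order √n.
f : ℕ → ℕ
f n = let q = suc ⌊log₄1+ n ⌋ in 2 * ((q + q) * 2 ^ q)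

n<2^n : ∀ n → n < 2 ^ n
n<2^n zero    = ≤-refl
n<2^n (suc n) = +-mono-≤ (m^n>0 2 n) (≤-trans (n<2^n n) (m≤m+n _ 0))

-- Writing `q = c + t` with `t ≥ c`, the left side is at most `2c(t + 1)`, and `2c ≤ 2 ^ c` and
-- `t + 1 ≤ 2 ^ t`.
linear≤2^ : ∀ c q → c + c ≤ q → c * suc q ≤ 2 ^ q
linear≤2^ c q 2c≤q with m≤n⇒∃[o]m+o≡n (m+n≤o⇒m≤o c 2c≤q)
... | t , refl = begin
  c * suc (c + t)             ≤⟨ *-monoʳ-≤ c (s≤s (+-monoˡ-≤ t (+-cancelˡ-≤ c c t 2c≤q))) ⟩
  c * suc (t + t)             ≤⟨ *-monoʳ-≤ c (n≤1+n _) ⟩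
  c * suc (suc (t + t))       ≡⟨ regroup c t ⟩
  2 * c * suc t               ≤⟨ *-mono-≤ (2*m≤2^m c) (n<2^n t) ⟩
  2 ^ c * 2 ^ t               ≡⟨ ^-distribˡ-+-* 2 c t ⟨
  2 ^ (c + t)                 ∎
  where
  open ≤-Reasoning
  regroup : ∀ x y → x * suc (suc (y + y)) ≡ 2 * x * suc y
  regroup = solve-∀
  2*m≤2^m : ∀ m → 2 * m ≤ 2 ^ m
  2*m≤2^m zero    = z≤n
  2*m≤2^m (suc m) = *-monoʳ-≤ 2 (n<2^n m)

f-littleO : LittleO-n f
f-littleO k _ = 2 ^ (c + c) * 2 ^ (c + c) , λ n N≤n → bound n N≤n (log₄ n) refl
  where
  -- The 8 collects three factors 2 of `f`: the outer one, the one in `ℓ = 2(q + 1)` and the one in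
  -- `h = 2 * 2 ^ q`. The extra 1 absorbs the successor in `suc n`.
  c : ℕ
  c = suc (8 * k)
  -- The equation ties `q` to the logarithm inside `f n`, which then becomes a formula in `q`.
  bound : ∀ n → 2 ^ (c + c) * 2 ^ (c + c) ≤ n →
          (l : ∃ λ q → 2 ^ q * 2 ^ q ≤ suc n × suc n < 2 ^ suc q * 2 ^ suc q) → l ≡ log₄ n → k * f n ≤ n
  bound n N≤n (q , 4^q≤ , <4^1+q) refl = s≤s⁻¹ (begin
    suc (k * (2 * ((suc q + suc q) * (2 * 2 ^ q))))   ≡⟨ cong suc (regroup k q (2 ^ q)) ⟩
    1 + 8 * k * (suc q * 2 ^ q)                       ≤⟨ +-monoˡ-≤ _ (*-mono-≤ (s≤s {n = q} z≤n) (m^n>0 2 q)) ⟩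
    c * (suc q * 2 ^ q)                               ≡⟨ *-assoc c (suc q) _ ⟨
    c * suc q * 2 ^ q                                 ≤⟨ *-monoˡ-≤ (2 ^ q) (linear≤2^ c q 2c≤q) ⟩
    2 ^ q * 2 ^ q                                     ≤⟨ 4^q≤ ⟩
    suc n                                             ∎)
    where
    open ≤-Reasoning
    regroup : ∀ x y z → x * (2 * ((suc y + suc y) * (2 * z))) ≡ 8 * x * (suc y * z)
    regroup = solve-∀
    2c≤q : c + c ≤ q
    -- Otherwise `n + 1 < 4 ^ (q + 1) ≤ 4 ^ (2c) ≤ n`.
    2c≤q = ≮⇒≥ λ q<2c → <⇒≱ (<-trans (s≤s N≤n) <4^1+q)
      (*-mono-≤ (^-monoʳ-≤ 2 q<2c) (^-monoʳ-≤ 2 q<2c))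

theorem4 : Σ (ℕ → ℕ) λ f → LittleO-n f × (∀ (n : ℕ) (D : Digraph n) → ChromaticAtLeast3 D → ∃ λ m → Cycle D m × suc m ≤ f n)
theorem4 = f , f-littleO , λ n D →
  let q , _ , 1+n<h² = log₄ n
      n<h² = <-trans (n<1+n n) 1+n<h²
  -- With these choices `2 ^ ℓ = h * h`, so the single bound `n < h * h` supplies both size
  -- hypotheses.
  in short-cycle D (2 ^ suc q) (suc q + suc q) {{m^n≢0 2 (suc q)}}
       (≤-trans n<h² (≤-reflexive (sym (^-distribˡ-+-* 2 (suc q) (suc q))))) (<⇒≤ n<h²)
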